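{- Let $G$ be a connected bipartite graph, with bipartition $(X,Y)$, which is not a star. Suppose $\gamma_t:V(G)\cup E(G)\to\{1,2\}$ is a total colouring in which the number of elements of $V(G)\cup E(G)$ coloured $1$ exceeds the number of elements coloured $2$, the latter being non-zero, and such that all vertices of one of $X,Y$ have even sums $\sigma^T$ and all vertices of the other have odd sums $\sigma^T$. Then there exists a total colouring $\gamma'_t:V(G)\cup E(G)\to\{1,2\}$ in which all vertices of one of $X,Y$ have even sums and all vertices of the other have odd sums, and which uses colour $2$ on exactly one more element of $V(G)\cup E(G)$ than $\gamma_t$ does.
   Context: For a total colouring $\gamma_t$ of $G$ (a not necessarily proper map on $V(G)\cup E(G)$), the sum at a vertex $v$ is $\sigma^T(v)=\gamma_t(v)+\sum_{e\ni v}\gamma_t(e)$. A star is a graph $K_{1,s}$, $s\geq 0$. -}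

module Defs where

open import Data.Nat using (ℕ; zero; suc; _+_; _≤_; _<_; _%_)
open import Data.Fin using (Fin; _≟_)
import Data.Fin as F
open import Data.Bool using (Bool; true; false; if_then_else_; _∨_)
open import Data.Product using (Σ; _×_; _,_; proj₁; proj₂; ∃)
open import Data.Sum using (_⊎_)
open import Relation.Nullary using (¬_)
open import Relation.Nullary.Decidable using (⌊_⌋)
open import Relation.Binary.PropositionalEquality using (_≡_; _≢_)

sumFin : (n : ℕ) → (Fin n → ℕ) → ℕ
sumFin zero    f = 0
sumFin (suc n) f = f F.zero + sumFin n (λ i → f (F.suc i))

record Graph : Set where
  field
    nV    : ℕ
    nE    : ℕ
    ends  : Fin nE → Fin nV × Fin nV
    loopless : ∀ e → proj₁ (ends e) ≢ proj₂ (ends e)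
    simple   : ∀ e f →
               (ends e ≡ ends f ⊎ ends e ≡ (proj₂ (ends f) , proj₁ (ends f))) →
               e ≡ f
open Graph public

Incident : (G : Graph) → Fin (nE G) → Fin (nV G) → Set
Incident G e v = proj₁ (ends G e) ≡ v ⊎ proj₂ (ends G e) ≡ v

incident? : (G : Graph) → Fin (nE G) → Fin (nV G) → Bool
incident? G e v = ⌊ proj₁ (ends G e) ≟ v ⌋ ∨ ⌊ proj₂ (ends G e) ≟ v ⌋

Adj : (G : Graph) → Fin (nV G) → Fin (nV G) → Set
Adj G u v = Σ (Fin (nE G)) λ e → ends G e ≡ (u , v) ⊎ ends G e ≡ (v , u)

data Reach (G : Graph) : Fin (nV G) → Fin (nV G) → Set where
  here : ∀ {u} → Reach G u u
  step : ∀ {u v w} → Adj G u v → Reach G v w → Reach G u w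

Connected : Graph → Set
Connected G = (1 ≤ nV G) × (∀ u v → Reach G u v)

-- (X,Y) given by side : V → Bool (X = side true, Y = side false) is a
-- bipartition: every edge joins X to Y
IsBipartition : (G : Graph) → (Fin (nV G) → Bool) → Set
IsBipartition G side = ∀ e → side (proj₁ (ends G e)) ≢ side (proj₂ (ends G e))

-- G is a star K_{1,s} (s ≥ 0): some centre c adjacent to every other
-- vertex, and every edge incident with c.
IsStar : Graph → Set
IsStar G = Σ (Fin (nV G)) λ c →
  (∀ v → v ≢ c → Adj G c v) × (∀ e → Incident G e c)

data Col : Set where
  c1 c2 : Col

val : Col → ℕ
val c1 = 1
val c2 = 2

is1 : Col → ℕ
is1 c1 = 1
is1 c2 = 0

is2 : Col → ℕ
is2 c1 = 0
is2 c2 = 1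

record TotalCol (G : Graph) : Set where
  field
    vcol : Fin (nV G) → Col
    ecol : Fin (nE G) → Col
open TotalCol public

σT : (G : Graph) → TotalCol G → Fin (nV G) → ℕ
σT G γ v = val (vcol γ v) +
  sumFin (nE G) (λ e → if incident? G e v then val (ecol γ e) else 0)

count1 : (G : Graph) → TotalCol G → ℕ
count1 G γ = sumFin (nV G) (λ v → is1 (vcol γ v)) + sumFin (nE G) (λ e → is1 (ecol γ e))

count2 : (G : Graph) → TotalCol G → ℕ
count2 G γ = sumFin (nV G) (λ v → is2 (vcol γ v)) + sumFin (nE G) (λ e → is2 (ecol γ e))

Even Odd : ℕ → Set
Even k = k % 2 ≡ 0
Odd  k = k % 2 ≡ 1

ParityOK : (G : Graph) → (Fin (nV G) → Bool) → TotalCol G → Set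
ParityOK G side γ =
    ((∀ v → side v ≡ true → Even (σT G γ v)) × (∀ v → side v ≡ false → Odd (σT G γ v)))
  ⊎ ((∀ v → side v ≡ true → Odd (σT G γ v)) × (∀ v → side v ≡ false → Even (σT G γ v)))

module Submission where

-- Lemma 3.  Toggling an edge e = ab exchanges the colours of a, e and b.  At a
-- and b two of the counted colours change, so every sum σᵀ keeps its parity;
-- and if one of a, e, b was coloured 2, the number count1 of 1s drops by at
-- most one.  Call such a toggle a move.
--   (1) Reduction: while some edge is coloured 1, a short sequence of moves
--       lowers the number of 1-edges by one (a case analysis around a vertex
--       with both a 1-edge and a 2-edge, using that G is connected, not a star,
--       and that every edge joins an even and an odd vertex).
--   (2) Counting: with no 1-edge the vertex colours are dictated by the
--       parities, so count1 equals the number of odd vertices, which is at most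
--       min(|V|, |E|) ≤ (|V| + |E|)/2 < count1 γ.
--   (3) Since moves lower count1 by at most one, the sequence of moves from γ
--       given by (1) and (2) passes a colouring with count1 γ − 1 ones.

open import Defs
open import Data.Nat using (ℕ; zero; suc; pred; _+_; _≤_; _<_; z≤n; s≤s; _%_; NonZero)
open import Data.Nat.Properties hiding (_≟_)
open import Data.Nat using () renaming (_≟_ to _≟ℕ_)
open import Data.Nat.DivMod using (%-distribˡ-+; [m+n]%n≡m%n; m%n<n)
open import Data.Fin using (Fin; _≟_)
import Data.Fin as F
open import Data.Bool using (Bool; true; false; if_then_else_; _∧_; _∨_)
open import Data.Bool.Properties using (∨-zeroʳ)
open import Data.Product using (Σ; _×_; _,_; proj₁; proj₂; swap)
open import Data.Sum using (_⊎_; inj₁; inj₂)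
open import Data.Empty using (⊥-elim)
open import Function using (_∘_)
open import Relation.Nullary using (¬_; yes; no; Dec)
open import Relation.Nullary.Decidable
  using (⌊_⌋; isYes≗does; dec-true; dec-false; decidable-stable; ¬?; _×-dec_; _⊎-dec_)
open import Data.Product.Properties using (≡-dec)
open import Relation.Binary.PropositionalEquality
import Data.Fin.Properties as FinP
import Algebra.Properties.CommutativeMonoid.Sum +-0-commutativeMonoid as Sum
open import Algebra.Properties.CommutativeSemigroup +-commutativeSemigroup using (interchange)

-- The frozen sumFin is the library's finite sum over the monoid (ℕ, +, 0);
-- this bridge lets us import the library's laws for sums.
sumFin≡sum : ∀ n (f : Fin n → ℕ) → sumFin n f ≡ Sum.sum f
sumFin≡sum zero    f = refl
sumFin≡sum (suc n) f = cong (f F.zero +_) (sumFin≡sum n (f ∘ F.suc))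

sum-cong : ∀ n {f g : Fin n → ℕ} → (∀ i → f i ≡ g i) → sumFin n f ≡ sumFin n g
sum-cong n {f} {g} f≗g =
  trans (sumFin≡sum n f) (trans (Sum.sum-cong-≗ f≗g) (sym (sumFin≡sum n g)))

sum-+ : ∀ n (f g : Fin n → ℕ) → sumFin n (λ i → f i + g i) ≡ sumFin n f + sumFin n g
sum-+ n f g = begin
  sumFin n (λ i → f i + g i)   ≡⟨ sumFin≡sum n _ ⟩
  Sum.sum (λ i → f i + g i)    ≡⟨ Sum.∑-distrib-+ f g ⟩
  Sum.sum f + Sum.sum g        ≡⟨ sym (cong₂ _+_ (sumFin≡sum n f) (sumFin≡sum n g)) ⟩
  sumFin n f + sumFin n g      ∎
  where open ≡-Reasoning

sum-swap : ∀ m n (h : Fin m → Fin n → ℕ) →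
           sumFin m (λ i → sumFin n (h i)) ≡ sumFin n (λ j → sumFin m (λ i → h i j))
sum-swap m n h = begin
  sumFin m (λ i → sumFin n (h i))           ≡⟨ double m n h ⟩
  Sum.sum (λ i → Sum.sum (h i))             ≡⟨ Sum.∑-comm h ⟩
  Sum.sum (λ j → Sum.sum (λ i → h i j))     ≡⟨ sym (double n m (λ j i → h i j)) ⟩
  sumFin n (λ j → sumFin m (λ i → h i j))   ∎
  where
  open ≡-Reasoning
  double : ∀ m n (k : Fin m → Fin n → ℕ) →
           sumFin m (λ i → sumFin n (k i)) ≡ Sum.sum (λ i → Sum.sum (k i))
  double m n k = trans (sumFin≡sum m _) (Sum.sum-cong-≗ (λ i → sumFin≡sum n (k i)))

sum-zeros : ∀ n → sumFin n (λ _ → 0) ≡ 0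
sum-zeros n = trans (sumFin≡sum n _) (Sum.sum-replicate-zero n)

sum-ones : ∀ n → sumFin n (λ _ → 1) ≡ n
sum-ones zero    = refl
sum-ones (suc n) = cong suc (sum-ones n)

sum-mono : ∀ n {f g : Fin n → ℕ} → (∀ i → f i ≤ g i) → sumFin n f ≤ sumFin n g
sum-mono zero    f≤g = z≤n
sum-mono (suc n) f≤g = +-mono-≤ (f≤g F.zero) (sum-mono n (f≤g ∘ F.suc))

sum-≤-length : ∀ n (f : Fin n → ℕ) → (∀ i → f i ≤ 1) → sumFin n f ≤ n
sum-≤-length n f f≤1 = subst (sumFin n f ≤_) (sum-ones n) (sum-mono n f≤1)

term≤sum : ∀ n (f : Fin n → ℕ) (i : Fin n) → f i ≤ sumFin n f
term≤sum (suc n) f F.zero    = m≤m+n (f F.zero) _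
term≤sum (suc n) f (F.suc i) = ≤-trans (term≤sum n (f ∘ F.suc) i) (m≤n+m _ (f F.zero))

nonzero-term : ∀ n (f : Fin n → ℕ) → sumFin n f ≢ 0 → Σ (Fin n) λ i → f i ≢ 0
nonzero-term zero    f sum≢0 = ⊥-elim (sum≢0 refl)
nonzero-term (suc n) f sum≢0 with f F.zero ≟ℕ 0
... | no f₀≢0 = F.zero , f₀≢0
... | yes f₀≡0 with nonzero-term n (f ∘ F.suc) (λ rest≡0 → sum≢0 (cong₂ _+_ f₀≡0 rest≡0))
...   | i , fᵢ≢0 = F.suc i , fᵢ≢0

sum-one-point : ∀ n (f : Fin n → ℕ) (p : Fin n) → (∀ i → i ≢ p → f i ≡ 0) → sumFin n f ≡ f p
sum-one-point (suc n) f F.zero    off =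
  trans (cong (f F.zero +_) (trans (sum-cong n (λ i → off (F.suc i) (λ ()))) (sum-zeros n)))
        (+-identityʳ (f F.zero))
sum-one-point (suc n) f (F.suc p) off = cong₂ _+_ (off F.zero (λ ()))
  (sum-one-point n (f ∘ F.suc) p (λ i i≢p → off (F.suc i) (i≢p ∘ FinP.suc-injective)))

sum-two-points : ∀ n (f : Fin n → ℕ) (p q : Fin n) → p ≢ q →
                 (∀ i → i ≢ p → i ≢ q → f i ≡ 0) → sumFin n f ≡ f p + f q
sum-two-points (suc n) f F.zero F.zero p≢q off = ⊥-elim (p≢q refl)
sum-two-points (suc n) f F.zero (F.suc q) p≢q off = cong (f F.zero +_)
  (sum-one-point n (f ∘ F.suc) q (λ i i≢q → off (F.suc i) (λ ()) (i≢q ∘ FinP.suc-injective)))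
sum-two-points (suc n) f (F.suc p) F.zero p≢q off =
  trans (cong (f F.zero +_)
          (sum-one-point n (f ∘ F.suc) p (λ i i≢p → off (F.suc i) (i≢p ∘ FinP.suc-injective) (λ ()))))
        (+-comm (f F.zero) (f (F.suc p)))
sum-two-points (suc n) f (F.suc p) (F.suc q) p≢q off = cong₂ _+_ (off F.zero (λ ()) (λ ()))
  (sum-two-points n (f ∘ F.suc) p q (p≢q ∘ cong F.suc)
    (λ i i≢p i≢q → off (F.suc i) (i≢p ∘ FinP.suc-injective) (i≢q ∘ FinP.suc-injective)))

⌊⌋-true : ∀ {A : Set} (a? : Dec A) → A → ⌊ a? ⌋ ≡ true
⌊⌋-true a? a = trans (isYes≗does a?) (dec-true a? a)

⌊⌋-false : ∀ {A : Set} (a? : Dec A) → ¬ A → ⌊ a? ⌋ ≡ false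
⌊⌋-false a? ¬a = trans (isYes≗does a?) (dec-false a? ¬a)

sum-indicator : ∀ n (h : Fin n → ℕ) (p : Fin n) →
                sumFin n (λ i → if ⌊ p ≟ i ⌋ then h i else 0) ≡ h p
sum-indicator n h p =
  trans (sum-one-point n _ p off) (cong (λ b → if b then h p else 0) (⌊⌋-true (p ≟ p) refl))
  where
  off : ∀ i → i ≢ p → (if ⌊ p ≟ i ⌋ then h i else 0) ≡ 0
  off i i≢p = cong (λ b → if b then h i else 0) (⌊⌋-false (p ≟ i) (i≢p ∘ sym))

+-mod-cong : ∀ d .{{_ : NonZero d}} {a a′ b b′ : ℕ} →
             a % d ≡ a′ % d → b % d ≡ b′ % d → (a + b) % d ≡ (a′ + b′) % d
+-mod-cong d {a} {a′} {b} {b′} a≡a′ b≡b′ = begin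
  (a + b) % d                  ≡⟨ %-distribˡ-+ a b d ⟩
  (a % d + b % d) % d          ≡⟨ cong₂ (λ x y → (x + y) % d) a≡a′ b≡b′ ⟩
  (a′ % d + b′ % d) % d        ≡⟨ sym (%-distribˡ-+ a′ b′ d) ⟩
  (a′ + b′) % d                ∎
  where open ≡-Reasoning

sum-mod-cong : ∀ d .{{_ : NonZero d}} n {f g : Fin n → ℕ} →
               (∀ i → f i % d ≡ g i % d) → sumFin n f % d ≡ sumFin n g % d
sum-mod-cong d zero    f≡g = refl
sum-mod-cong d (suc n) f≡g = +-mod-cong d (f≡g F.zero) (sum-mod-cong d n (f≡g ∘ F.suc))

search : ∀ {n} {P : Fin n → Set} → (∀ i → Dec (P i)) → Σ (Fin n) P ⊎ (∀ i → ¬ P i)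
search P? with FinP.any? P?
... | yes (i , pᵢ) = inj₁ (i , pᵢ)
... | no none = inj₂ (λ i pᵢ → none (i , pᵢ))

flip : Col → Col
flip c1 = c2
flip c2 = c1

is1≤1 : ∀ c → is1 c ≤ 1
is1≤1 c1 = ≤-refl
is1≤1 c2 = z≤n

is1-flip : ∀ c → is1 c + is1 (flip c) ≡ 1
is1-flip c1 = refl
is1-flip c2 = refl

is1+is2 : ∀ c → is1 c + is2 c ≡ 1
is1+is2 c1 = refl
is1+is2 c2 = refl

val-parity : ∀ c → val c % 2 ≡ is1 c % 2
val-parity c1 = refl
val-parity c2 = refl

c1≢c2 : c1 ≢ c2
c1≢c2 ()

other-than-c2 : ∀ {c} → c ≢ c2 → c ≡ c1
other-than-c2 {c1} _    = refl
other-than-c2 {c2} c≢c2 = ⊥-elim (c≢c2 refl)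

other-than-c1 : ∀ {c} → c ≢ c1 → c ≡ c2
other-than-c1 {c1} c≢c1 = ⊥-elim (c≢c1 refl)
other-than-c1 {c2} _    = refl

_≟ᶜ_ : (c d : Col) → Dec (c ≡ d)
c1 ≟ᶜ c1 = yes refl
c1 ≟ᶜ c2 = no (λ ())
c2 ≟ᶜ c1 = no (λ ())
c2 ≟ᶜ c2 = yes refl

ones : ∀ {n} → (Fin n → Bool) → (Fin n → Col) → ℕ
ones {n} M c = sumFin n (λ i → if M i then is1 (c i) else 0)

flipOn : ∀ {n} → (Fin n → Bool) → (Fin n → Col) → Fin n → Col
flipOn P c i = if P i then flip (c i) else c i

-- Flipping the positions P changes the number of 1s inside M only on M ∩ P,
-- where every 1 becomes a 2 and vice versa.
ones-flipOn : ∀ {n} (P M : Fin n → Bool) (c : Fin n → Col) →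
              ones M (flipOn P c) + ones (λ i → M i ∧ P i) c
                ≡ ones M c + ones (λ i → M i ∧ P i) (flip ∘ c)
ones-flipOn {n} P M c = begin
  ones M (flipOn P c) + ones M∩P c                  ≡⟨ sym (sum-+ n before correction) ⟩
  sumFin n (λ i → before i + correction i)          ≡⟨ sum-cong n (λ i → termwise (M i) (P i) (c i)) ⟩
  sumFin n (λ i → after i + correction′ i)          ≡⟨ sum-+ n after correction′ ⟩
  ones M c + ones M∩P (flip ∘ c)                    ∎
  where
  open ≡-Reasoning
  M∩P : Fin n → Bool
  M∩P i = M i ∧ P i
  before after correction correction′ : Fin n → ℕ
  before i      = if M i then is1 (flipOn P c i) else 0
  after i       = if M i then is1 (c i) else 0
  correction i  = if M∩P i then is1 (c i) else 0
  correction′ i = if M∩P i then is1 (flip (c i)) else 0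
  termwise : ∀ m p x → (if m then is1 (if p then flip x else x) else 0) + (if m ∧ p then is1 x else 0)
                       ≡ (if m then is1 x else 0) + (if m ∧ p then is1 (flip x) else 0)
  termwise true  true  x = +-comm (is1 (flip x)) (is1 x)
  termwise true  false x = refl
  termwise false p     x = refl

ones₃ : Col → Col → Col → ℕ
ones₃ a b c = is1 a + is1 b + is1 c

-- each colour contributes one 1 to ones₃ of the colours and of their flips
ones₃-flip : ∀ a b c → ones₃ a b c + ones₃ (flip a) (flip b) (flip c) ≡ 3
ones₃-flip a b c = begin
  (is1 a + is1 b + is1 c) + (is1 (flip a) + is1 (flip b) + is1 (flip c))
    ≡⟨ interchange (is1 a + is1 b) (is1 c) (is1 (flip a) + is1 (flip b)) (is1 (flip c)) ⟩
  (is1 a + is1 b + (is1 (flip a) + is1 (flip b))) + (is1 c + is1 (flip c))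
    ≡⟨ cong (_+ (is1 c + is1 (flip c))) (interchange (is1 a) (is1 b) (is1 (flip a)) (is1 (flip b))) ⟩
  ((is1 a + is1 (flip a)) + (is1 b + is1 (flip b))) + (is1 c + is1 (flip c))
    ≡⟨ cong₂ _+_ (cong₂ _+_ (is1-flip a) (is1-flip b)) (is1-flip c) ⟩
  3 ∎
  where open ≡-Reasoning

ones₃-≤2 : ∀ a b c → a ≡ c2 ⊎ b ≡ c2 ⊎ c ≡ c2 → ones₃ a b c ≤ 2
ones₃-≤2 .c2 b c (inj₁ refl)        = +-mono-≤ (is1≤1 b) (is1≤1 c)
ones₃-≤2 a .c2 c (inj₂ (inj₁ refl)) = +-mono-≤ (+-mono-≤ (is1≤1 a) (z≤n {0})) (is1≤1 c)
ones₃-≤2 a b .c2 (inj₂ (inj₂ refl)) = +-mono-≤ (+-mono-≤ (is1≤1 a) (is1≤1 b)) z≤n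

drop-by-at-most-one : ∀ {x y s s′} → y + s ≡ x + s′ → s + s′ ≡ 3 → s ≤ 2 → x ≤ suc y
drop-by-at-most-one {x} {y} {s} {s′} eq total s≤2 = +-cancelʳ-≤ 3 x (suc y) (begin
  x + 3           ≡⟨ cong (x +_) (trans (sym total) (+-comm s s′)) ⟩
  x + (s′ + s)    ≡⟨ sym (+-assoc x s′ s) ⟩
  x + s′ + s      ≡⟨ cong (_+ s) (sym eq) ⟩
  y + s + s       ≤⟨ +-mono-≤ (+-monoʳ-≤ y s≤2) s≤2 ⟩
  y + 2 + 2       ≡⟨ trans (+-assoc y 2 2) (+-suc y 3) ⟩
  suc y + 3       ∎)
  where open ≤-Reasoning

zero≢one : ∀ {x y : ℕ} → x ≡ 0 → y ≡ 1 → x ≢ y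
zero≢one x≡0 y≡1 x≡y = 0≢1+n (trans (sym x≡0) (trans x≡y y≡1))

flip-pair-parity : ∀ a b {N N′} → N′ + (is1 a + is1 b) ≡ N + (is1 (flip a) + is1 (flip b)) →
                   N′ % 2 ≡ N % 2
flip-pair-parity c1 c1 {N} {N′} eq = trans (sym ([m+n]%n≡m%n N′ 2)) (cong (_% 2) (trans eq (+-identityʳ N)))
flip-pair-parity c1 c2 {N} {N′} eq = cong (_% 2) (+-cancelʳ-≡ 1 N′ N eq)
flip-pair-parity c2 c1 {N} {N′} eq = cong (_% 2) (+-cancelʳ-≡ 1 N′ N eq)
flip-pair-parity c2 c2 {N} {N′} eq = trans (cong (_% 2) (trans (sym (+-identityʳ N′)) eq)) ([m+n]%n≡m%n N 2)

-- At a vertex v the count is is1 (colour of v) + A, with A the number of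
-- incident 1-edges; toggling an edge changes it by an even amount whether or
-- not the edge is at v (b).
toggle-parity : ∀ (b : Bool) cv ce {A A′} →
                A′ + (if b then is1 ce else 0) ≡ A + (if b then is1 (flip ce) else 0) →
                (is1 (if b then flip cv else cv) + A′) % 2 ≡ (is1 cv + A) % 2
toggle-parity false cv ce {A} {A′} eq = cong (λ z → (is1 cv + z) % 2) (+-cancelʳ-≡ 0 A′ A eq)
toggle-parity true  cv ce {A} {A′} eq = flip-pair-parity cv ce {is1 cv + A} {is1 (flip cv) + A′} (begin
  (is1 (flip cv) + A′) + (is1 cv + is1 ce)       ≡⟨ interchange (is1 (flip cv)) A′ (is1 cv) (is1 ce) ⟩
  (is1 (flip cv) + is1 cv) + (A′ + is1 ce)       ≡⟨ cong₂ _+_ (+-comm (is1 (flip cv)) (is1 cv)) eq ⟩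
  (is1 cv + is1 (flip cv)) + (A + is1 (flip ce)) ≡⟨ interchange (is1 cv) (is1 (flip cv)) A (is1 (flip ce)) ⟩
  (is1 cv + A) + (is1 (flip cv) + is1 (flip ce)) ∎)
  where open ≡-Reasoning

module _ (G : Graph) where

  Vertex Edge : Set
  Vertex = Fin (nV G)
  Edge   = Fin (nE G)

  end₁ end₂ : Edge → Vertex
  end₁ e = proj₁ (ends G e)
  end₂ e = proj₂ (ends G e)

  Joins : Edge → Vertex → Vertex → Set
  Joins e a b = ends G e ≡ (a , b) ⊎ ends G e ≡ (b , a)

  joins-ends : ∀ e → Joins e (end₁ e) (end₂ e)
  joins-ends e = inj₁ refl

  joins-sym : ∀ {e a b} → Joins e a b → Joins e b a
  joins-sym (inj₁ p) = inj₂ p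
  joins-sym (inj₂ p) = inj₁ p

  joins-distinct : ∀ {e a b} → Joins e a b → a ≢ b
  joins-distinct {e} (inj₁ p) refl = loopless G e (trans (cong proj₁ p) (sym (cong proj₂ p)))
  joins-distinct {e} (inj₂ p) refl = loopless G e (trans (cong proj₁ p) (sym (cong proj₂ p)))

  joins-unique : ∀ {e f a b} → Joins e a b → Joins f a b → e ≡ f
  joins-unique {e} {f} (inj₁ p) (inj₁ q) = simple G e f (inj₁ (trans p (sym q)))
  joins-unique {e} {f} (inj₁ p) (inj₂ q) = simple G e f (inj₂ (trans p (sym (cong swap q))))
  joins-unique {e} {f} (inj₂ p) (inj₁ q) = simple G e f (inj₂ (trans p (sym (cong swap q))))
  joins-unique {e} {f} (inj₂ p) (inj₂ q) = simple G e f (inj₁ (trans p (sym q)))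

  joins-other : ∀ {e a b c} → Joins e a b → Joins e b c → c ≡ a
  joins-other p@(inj₁ p′) (inj₁ q) = ⊥-elim (joins-distinct p (trans (sym (cong proj₁ p′)) (cong proj₁ q)))
  joins-other (inj₁ p) (inj₂ q) = trans (sym (cong proj₁ q)) (cong proj₁ p)
  joins-other (inj₂ p) (inj₁ q) = trans (sym (cong proj₂ q)) (cong proj₂ p)
  joins-other p@(inj₂ p′) (inj₂ q) = ⊥-elim (joins-distinct p (trans (sym (cong proj₂ p′)) (cong proj₂ q)))

  joins→incident : ∀ {e a b} → Joins e a b → Incident G e a
  joins→incident (inj₁ p) = inj₁ (cong proj₁ p)
  joins→incident (inj₂ p) = inj₂ (cong proj₂ p)

  incident→joins : ∀ {e a} → Incident G e a → Σ Vertex (Joins e a)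
  incident→joins {e} (inj₁ p) = end₂ e , inj₁ (cong (_, end₂ e) p)
  incident→joins {e} (inj₂ p) = end₁ e , inj₂ (cong (end₁ e ,_) p)

  incident?-end : ∀ {e a b} → Joins e a b → incident? G e a ≡ true
  incident?-end {e} {a} (inj₁ p) = cong (_∨ ⌊ end₂ e ≟ a ⌋) (⌊⌋-true (end₁ e ≟ a) (cong proj₁ p))
  incident?-end {e} {a} (inj₂ p) =
    trans (cong (⌊ end₁ e ≟ a ⌋ ∨_) (⌊⌋-true (end₂ e ≟ a) (cong proj₂ p))) (∨-zeroʳ ⌊ end₁ e ≟ a ⌋)

  incident?-away : ∀ {e a b x} → Joins e a b → x ≢ a → x ≢ b → incident? G e x ≡ false
  incident?-away {e} {x = x} (inj₁ p) x≢a x≢b = cong₂ _∨_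
    (⌊⌋-false (end₁ e ≟ x) (λ q → x≢a (trans (sym q) (cong proj₁ p))))
    (⌊⌋-false (end₂ e ≟ x) (λ q → x≢b (trans (sym q) (cong proj₂ p))))
  incident?-away {e} {x = x} (inj₂ p) x≢a x≢b = cong₂ _∨_
    (⌊⌋-false (end₁ e ≟ x) (λ q → x≢b (trans (sym q) (cong proj₁ p))))
    (⌊⌋-false (end₂ e ≟ x) (λ q → x≢a (trans (sym q) (cong proj₂ p))))

  incident?→incident : ∀ e x → incident? G e x ≡ true → Incident G e x
  incident?→incident e x is-incident with end₁ e ≟ x | end₂ e ≟ x
  ... | yes p | _     = inj₁ p
  ... | no _  | yes q = inj₂ q
  ... | no _  | no _  = ⊥-elim (false≢true is-incident)
    where
    false≢true : false ≢ true
    false≢true ()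

  sum-over-ends : ∀ e (h : Vertex → ℕ) →
                  sumFin (nV G) (λ v → if incident? G e v then h v else 0) ≡ h (end₁ e) + h (end₂ e)
  sum-over-ends e h =
    trans (sum-two-points (nV G) _ (end₁ e) (end₂ e) (loopless G e) off)
          (cong₂ _+_ (at (joins-ends e)) (at (joins-sym (joins-ends e))))
    where
    at : ∀ {a b} → Joins e a b → (if incident? G e a then h a else 0) ≡ h a
    at {a} j = cong (λ t → if t then h a else 0) (incident?-end j)
    off : ∀ v → v ≢ end₁ e → v ≢ end₂ e → (if incident? G e v then h v else 0) ≡ 0
    off v v≢a v≢b = cong (λ t → if t then h v else 0) (incident?-away (joins-ends e) v≢a v≢b)

  toggle : TotalCol G → Edge → TotalCol G
  toggle γ e = record { vcol = flipOn (incident? G e) (vcol γ)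
                      ; ecol = flipOn (λ f → ⌊ e ≟ f ⌋) (ecol γ) }

  toggle-end : ∀ γ {e a b} → Joins e a b → vcol (toggle γ e) a ≡ flip (vcol γ a)
  toggle-end γ {a = a} j = cong (λ t → if t then flip (vcol γ a) else vcol γ a) (incident?-end j)

  toggle-away : ∀ γ {e a b x} → Joins e a b → x ≢ a → x ≢ b → vcol (toggle γ e) x ≡ vcol γ x
  toggle-away γ {x = x} j x≢a x≢b =
    cong (λ t → if t then flip (vcol γ x) else vcol γ x) (incident?-away j x≢a x≢b)

  toggle-edge : ∀ γ e → ecol (toggle γ e) e ≡ flip (ecol γ e)
  toggle-edge γ e = cong (λ t → if t then flip (ecol γ e) else ecol γ e) (⌊⌋-true (e ≟ e) refl)

  toggle-other : ∀ γ {e f} → f ≢ e → ecol (toggle γ e) f ≡ ecol γ f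
  toggle-other γ {e} {f} f≢e =
    cong (λ t → if t then flip (ecol γ f) else ecol γ f) (⌊⌋-false (e ≟ f) (f≢e ∘ sym))

  count₁ : ∀ {n} → (Fin n → Col) → ℕ
  count₁ = ones (λ _ → true)

  edgeOnes : TotalCol G → ℕ
  edgeOnes γ = count₁ (ecol γ)

  edgeOnes-toggle : ∀ γ e → edgeOnes (toggle γ e) + is1 (ecol γ e) ≡ edgeOnes γ + is1 (flip (ecol γ e))
  edgeOnes-toggle γ e = begin
    edgeOnes (toggle γ e) + is1 (ecol γ e)        ≡⟨ cong (edgeOnes (toggle γ e) +_)
                                                       (sym (sum-indicator (nE G) (is1 ∘ ecol γ) e)) ⟩
    edgeOnes (toggle γ e) + ones at-e (ecol γ)    ≡⟨ ones-flipOn at-e (λ _ → true) (ecol γ) ⟩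
    edgeOnes γ + ones at-e (flip ∘ ecol γ)        ≡⟨ cong (edgeOnes γ +_)
                                                       (sum-indicator (nE G) (is1 ∘ flip ∘ ecol γ) e) ⟩
    edgeOnes γ + is1 (flip (ecol γ e))            ∎
    where
    open ≡-Reasoning
    at-e = λ f → ⌊ e ≟ f ⌋

  edgeOnes-down : ∀ γ e → ecol γ e ≡ c1 → suc (edgeOnes (toggle γ e)) ≡ edgeOnes γ
  edgeOnes-down γ e e₁ = begin
    suc (edgeOnes (toggle γ e))              ≡⟨ +-comm 1 _ ⟩
    edgeOnes (toggle γ e) + is1 c1           ≡⟨ cong (λ c → edgeOnes (toggle γ e) + is1 c) (sym e₁) ⟩
    edgeOnes (toggle γ e) + is1 (ecol γ e)   ≡⟨ edgeOnes-toggle γ e ⟩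
    edgeOnes γ + is1 (flip (ecol γ e))       ≡⟨ cong (λ c → edgeOnes γ + is1 (flip c)) e₁ ⟩
    edgeOnes γ + 0                           ≡⟨ +-identityʳ _ ⟩
    edgeOnes γ                               ∎
    where open ≡-Reasoning

  edgeOnes-up : ∀ γ e → ecol γ e ≡ c2 → edgeOnes (toggle γ e) ≡ suc (edgeOnes γ)
  edgeOnes-up γ e e₂ = begin
    edgeOnes (toggle γ e)                    ≡⟨ sym (+-identityʳ _) ⟩
    edgeOnes (toggle γ e) + is1 c2           ≡⟨ cong (λ c → edgeOnes (toggle γ e) + is1 c) (sym e₂) ⟩
    edgeOnes (toggle γ e) + is1 (ecol γ e)   ≡⟨ edgeOnes-toggle γ e ⟩
    edgeOnes γ + is1 (flip (ecol γ e))       ≡⟨ cong (λ c → edgeOnes γ + is1 (flip c)) e₂ ⟩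
    edgeOnes γ + 1                           ≡⟨ +-comm _ 1 ⟩
    suc (edgeOnes γ)                         ∎
    where open ≡-Reasoning

  vertexOnes-toggle : ∀ γ e →
    count₁ (vcol (toggle γ e)) + (is1 (vcol γ (end₁ e)) + is1 (vcol γ (end₂ e)))
      ≡ count₁ (vcol γ) + (is1 (flip (vcol γ (end₁ e))) + is1 (flip (vcol γ (end₂ e))))
  vertexOnes-toggle γ e = begin
    count₁ (vcol (toggle γ e)) + (a + b)              ≡⟨ cong (count₁ (vcol (toggle γ e)) +_)
                                                           (sym (sum-over-ends e (is1 ∘ vcol γ))) ⟩
    count₁ (vcol (toggle γ e)) + ones ends-e (vcol γ) ≡⟨ ones-flipOn ends-e (λ _ → true) (vcol γ) ⟩
    count₁ (vcol γ) + ones ends-e (flip ∘ vcol γ)     ≡⟨ cong (count₁ (vcol γ) +_)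
                                                           (sum-over-ends e (is1 ∘ flip ∘ vcol γ)) ⟩
    count₁ (vcol γ) + (a′ + b′)                       ∎
    where
    open ≡-Reasoning
    ends-e : Vertex → Bool
    ends-e = incident? G e
    a b a′ b′ : ℕ
    a  = is1 (vcol γ (end₁ e))
    b  = is1 (vcol γ (end₂ e))
    a′ = is1 (flip (vcol γ (end₁ e)))
    b′ = is1 (flip (vcol γ (end₂ e)))

  closedOnes : TotalCol G → Edge → ℕ
  closedOnes γ e = ones₃ (vcol γ (end₁ e)) (vcol γ (end₂ e)) (ecol γ e)

  closedOnes-flipped : TotalCol G → Edge → ℕ
  closedOnes-flipped γ e = ones₃ (flip (vcol γ (end₁ e))) (flip (vcol γ (end₂ e))) (flip (ecol γ e))

  count1-toggle : ∀ γ e → count1 G (toggle γ e) + closedOnes γ e ≡ count1 G γ + closedOnes-flipped γ e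
  count1-toggle γ e = begin
    (V′ + E′) + ((a + b) + c)     ≡⟨ interchange V′ E′ (a + b) c ⟩
    (V′ + (a + b)) + (E′ + c)     ≡⟨ cong₂ _+_ (vertexOnes-toggle γ e) (edgeOnes-toggle γ e) ⟩
    (V + (a′ + b′)) + (E + c′)    ≡⟨ interchange V (a′ + b′) E c′ ⟩
    (V + E) + ((a′ + b′) + c′)    ∎
    where
    open ≡-Reasoning
    V′ E′ V E a b c a′ b′ c′ : ℕ
    V′ = count₁ (vcol (toggle γ e))
    E′ = edgeOnes (toggle γ e)
    V  = count₁ (vcol γ)
    E  = edgeOnes γ
    a  = is1 (vcol γ (end₁ e))
    b  = is1 (vcol γ (end₂ e))
    c  = is1 (ecol γ e)
    a′ = is1 (flip (vcol γ (end₁ e)))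
    b′ = is1 (flip (vcol γ (end₂ e)))
    c′ = is1 (flip (ecol γ e))

  -- Toggles allowed in a move: the closed edge of e carries a 2.  Such a toggle
  -- lowers the number of 1s by at most one.
  TwoOn : TotalCol G → Edge → Set
  TwoOn γ e = vcol γ (end₁ e) ≡ c2 ⊎ vcol γ (end₂ e) ≡ c2 ⊎ ecol γ e ≡ c2

  two-at-edge : ∀ γ {e} → ecol γ e ≡ c2 → TwoOn γ e
  two-at-edge γ = inj₂ ∘ inj₂

  two-at-end : ∀ γ {e a b} → Joins e a b → vcol γ a ≡ c2 → TwoOn γ e
  two-at-end γ (inj₁ p) a₂ = inj₁ (subst (λ x → vcol γ x ≡ c2) (sym (cong proj₁ p)) a₂)
  two-at-end γ (inj₂ p) a₂ = inj₂ (inj₁ (subst (λ x → vcol γ x ≡ c2) (sym (cong proj₂ p)) a₂))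

  count1-toggle-drop : ∀ γ e → TwoOn γ e → count1 G γ ≤ suc (count1 G (toggle γ e))
  count1-toggle-drop γ e two = drop-by-at-most-one (count1-toggle γ e)
    (ones₃-flip (vcol γ (end₁ e)) (vcol γ (end₂ e)) (ecol γ e))
    (ones₃-≤2 (vcol γ (end₁ e)) (vcol γ (end₂ e)) (ecol γ e) two)

  parity : TotalCol G → Vertex → ℕ
  parity γ v = σT G γ v % 2

  incidentOnes : TotalCol G → Vertex → ℕ
  incidentOnes γ v = ones (λ e → incident? G e v) (ecol γ)

  -- since val c ≡ is1 c (mod 2), σᵀ(v) is congruent to the number of 1s at v
  parity-by-ones : ∀ γ v → parity γ v ≡ (is1 (vcol γ v) + incidentOnes γ v) % 2
  parity-by-ones γ v =
    +-mod-cong 2 {val (vcol γ v)} {is1 (vcol γ v)}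
      {sumFin (nE G) (λ e → if incident? G e v then val (ecol γ e) else 0)} {incidentOnes γ v}
      (val-parity (vcol γ v))
      (sum-mod-cong 2 (nE G) (λ e → termwise (incident? G e v) (ecol γ e)))
    where
    termwise : ∀ b c → (if b then val c else 0) % 2 ≡ (if b then is1 c else 0) % 2
    termwise true  c = val-parity c
    termwise false c = refl

  incidentOnes-toggle : ∀ γ e v →
    incidentOnes (toggle γ e) v + (if incident? G e v then is1 (ecol γ e) else 0)
      ≡ incidentOnes γ v + (if incident? G e v then is1 (flip (ecol γ e)) else 0)
  incidentOnes-toggle γ e v = begin
    incidentOnes (toggle γ e) v + at-e (ecol γ)                  ≡⟨ cong (incidentOnes (toggle γ e) v +_)
                                                                      (sym (correction (ecol γ))) ⟩
    incidentOnes (toggle γ e) v + ones at-v∩e (ecol γ)          ≡⟨ ones-flipOn (λ f → ⌊ e ≟ f ⌋) at-v (ecol γ) ⟩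
    incidentOnes γ v + ones at-v∩e (flip ∘ ecol γ)              ≡⟨ cong (incidentOnes γ v +_)
                                                                      (correction (flip ∘ ecol γ)) ⟩
    incidentOnes γ v + at-e (flip ∘ ecol γ)                      ∎
    where
    open ≡-Reasoning
    at-v at-v∩e : Edge → Bool
    at-v f   = incident? G f v
    at-v∩e f = at-v f ∧ ⌊ e ≟ f ⌋
    at-e : (Edge → Col) → ℕ
    at-e c = if incident? G e v then is1 (c e) else 0
    if-∧ : ∀ m p (t : ℕ) → (if m ∧ p then t else 0) ≡ (if p then (if m then t else 0) else 0)
    if-∧ true  p     t = refl
    if-∧ false true  t = refl
    if-∧ false false t = refl
    correction : ∀ c → ones at-v∩e c ≡ at-e c
    correction c = trans (sum-cong (nE G) (λ f → if-∧ (at-v f) ⌊ e ≟ f ⌋ (is1 (c f))))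
                         (sum-indicator (nE G) (λ f → if at-v f then is1 (c f) else 0) e)

  parity-toggle : ∀ γ e v → parity (toggle γ e) v ≡ parity γ v
  parity-toggle γ e v = begin
    parity (toggle γ e) v                                ≡⟨ parity-by-ones (toggle γ e) v ⟩
    (is1 (vcol (toggle γ e) v) + incidentOnes (toggle γ e) v) % 2
      ≡⟨ toggle-parity (incident? G e v) (vcol γ v) (ecol γ e) (incidentOnes-toggle γ e v) ⟩
    (is1 (vcol γ v) + incidentOnes γ v) % 2              ≡⟨ sym (parity-by-ones γ v) ⟩
    parity γ v                                           ∎
    where open ≡-Reasoning

  data Moves (γ : TotalCol G) : TotalCol G → Set where
    stop : Moves γ γ
    move : ∀ {γ′} e → TwoOn γ e → Moves (toggle γ e) γ′ → Moves γ γ′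

  _++ᴹ_ : ∀ {γ γ′ γ″} → Moves γ γ′ → Moves γ′ γ″ → Moves γ γ″
  stop             ++ᴹ later = later
  move e two moves ++ᴹ later = move e two (moves ++ᴹ later)

  moves-parity : ∀ {γ γ′} → Moves γ γ′ → ∀ v → parity γ′ v ≡ parity γ v
  moves-parity     stop               v = refl
  moves-parity {γ} (move e two moves) v = trans (moves-parity moves v) (parity-toggle γ e v)

  -- Discrete intermediate value theorem: along a sequence of moves the number
  -- of 1s never drops by more than one, so every value between its initial and
  -- final value is attained.
  intermediate-count : ∀ {γ γ′} → Moves γ γ′ → ∀ t → t ≤ count1 G γ → count1 G γ′ ≤ t →
                       Σ (TotalCol G) λ γ″ → Moves γ γ″ × count1 G γ″ ≡ t
  intermediate-count {γ} stop t t≤c c≤t = γ , stop , ≤-antisym c≤t t≤c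
  intermediate-count {γ} (move e two moves) t t≤c c′≤t with count1 G γ ≟ℕ t
  ... | yes c≡t = γ , stop , c≡t
  ... | no c≢t =
    let γ″ , moves″ , c″≡t = intermediate-count moves t t≤c₁ c′≤t in γ″ , move e two moves″ , c″≡t
    where
    t≤c₁ : t ≤ count1 G (toggle γ e)
    t≤c₁ = ≤-pred (≤-trans (≤∧≢⇒< t≤c (c≢t ∘ sym)) (count1-toggle-drop γ e two))

  Reduction : TotalCol G → Set
  Reduction γ = Σ (TotalCol G) λ γ′ → Moves γ γ′ × suc (edgeOnes γ′) ≡ edgeOnes γ

  colours-differ : ∀ (γ : TotalCol G) {e f} → ecol γ e ≡ c1 → ecol γ f ≡ c2 → e ≢ f
  colours-differ γ e₁ f₂ refl = c1≢c2 (trans (sym e₁) f₂)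

  edgeOnes-up-down : ∀ γ {e f} → ecol γ f ≡ c2 → ecol (toggle γ f) e ≡ c1 →
                     edgeOnes (toggle (toggle γ f) e) ≡ edgeOnes γ
  edgeOnes-up-down γ {e} {f} f₂ e₁ = suc-injective (trans (edgeOnes-down (toggle γ f) e e₁) (edgeOnes-up γ f f₂))

  reduce-at-end : ∀ {γ e a b} → Joins e a b → ecol γ e ≡ c1 → vcol γ a ≡ c2 → Reduction γ
  reduce-at-end {γ} {e} j e₁ a₂ = toggle γ e , move e (two-at-end γ j a₂) stop , edgeOnes-down γ e e₁

  -- w —f— u —e— v with f a 2-edge, e a 1-edge and u, w coloured 1:
  -- toggle f, then e, then f again
  reduce-there-and-back : ∀ {γ e f u v w} → Joins e u v → Joins f u w →
                          ecol γ e ≡ c1 → ecol γ f ≡ c2 → vcol γ u ≡ c1 → vcol γ w ≡ c1 → Reduction γ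
  reduce-there-and-back {γ} {e} {f} {u} {v} {w} je jf e₁ f₂ u₁ w₁ =
    γ₃ , move f (two-at-edge γ f₂) (move e (two-at-end γ₁ je u₂)
                                     (move f (two-at-end γ₂ (joins-sym jf) w₂) stop)) ,
    trans (edgeOnes-down γ₂ f f₁) (edgeOnes-up-down γ f₂ e₁′)
    where
    γ₁ γ₂ γ₃ : TotalCol G
    γ₁ = toggle γ f
    γ₂ = toggle γ₁ e
    γ₃ = toggle γ₂ f
    e≢f : e ≢ f
    e≢f = colours-differ γ e₁ f₂
    w≢u : w ≢ u
    w≢u = joins-distinct jf ∘ sym
    w≢v : w ≢ v
    w≢v refl = e≢f (joins-unique je jf)
    u₂ : vcol γ₁ u ≡ c2
    u₂ = trans (toggle-end γ jf) (cong flip u₁)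
    e₁′ : ecol γ₁ e ≡ c1
    e₁′ = trans (toggle-other γ e≢f) e₁
    w₂ : vcol γ₂ w ≡ c2
    w₂ = trans (toggle-away γ₁ je w≢u w≢v) (trans (toggle-end γ (joins-sym jf)) (cong flip w₁))
    f₁ : ecol γ₂ f ≡ c1
    f₁ = trans (toggle-other γ₁ (e≢f ∘ sym)) (trans (toggle-edge γ f) (cong flip f₂))

  -- w —f— u —e— v —g— x with f a 2-edge, e, g 1-edges and u, v coloured 1:
  -- toggle f, e, g in turn
  reduce-path : ∀ {γ e f g u v w x} → Joins e u v → Joins f u w → Joins g v x →
                ecol γ e ≡ c1 → ecol γ f ≡ c2 → ecol γ g ≡ c1 → g ≢ e →
                vcol γ u ≡ c1 → vcol γ v ≡ c1 → Reduction γ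
  reduce-path {γ} {e} {f} {g} {u} {v} {w} je jf jg e₁ f₂ g₁ g≢e u₁ v₁ =
    γ₃ , move f (two-at-edge γ f₂) (move e (two-at-end γ₁ je u₂) (move g (two-at-end γ₂ jg v₂) stop)) ,
    trans (edgeOnes-down γ₂ g g₁′) (edgeOnes-up-down γ f₂ e₁′)
    where
    γ₁ γ₂ γ₃ : TotalCol G
    γ₁ = toggle γ f
    γ₂ = toggle γ₁ e
    γ₃ = toggle γ₂ g
    e≢f : e ≢ f
    e≢f = colours-differ γ e₁ f₂
    v≢u : v ≢ u
    v≢u = joins-distinct je ∘ sym
    v≢w : v ≢ w
    v≢w refl = e≢f (joins-unique je jf)
    u₂ : vcol γ₁ u ≡ c2
    u₂ = trans (toggle-end γ jf) (cong flip u₁)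
    e₁′ : ecol γ₁ e ≡ c1
    e₁′ = trans (toggle-other γ e≢f) e₁
    v₂ : vcol γ₂ v ≡ c2
    v₂ = trans (toggle-end γ₁ (joins-sym je)) (cong flip (trans (toggle-away γ jf v≢u v≢w) v₁))
    g₁′ : ecol γ₂ g ≡ c1
    g₁′ = trans (toggle-other γ₁ g≢e) (trans (toggle-other γ (colours-differ γ g₁ f₂)) g₁)

  -- y —e′— u —e— v, u —f— w —g— x with e, e′ 1-edges, f, g 2-edges, u coloured 1
  -- and w coloured 2: toggling f and e leads to the situation of reduce-path
  -- along x —g— w —f— u —e′— y
  reduce-detour : ∀ {γ e e′ f g u v w x y} → Joins e u v → Joins e′ u y → e′ ≢ e →
                  Joins f u w → Joins g w x → g ≢ f →
                  ecol γ e ≡ c1 → ecol γ e′ ≡ c1 → ecol γ f ≡ c2 → ecol γ g ≡ c2 →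
                  vcol γ u ≡ c1 → vcol γ w ≡ c2 → Reduction γ
  reduce-detour {γ} {e} {e′} {f} {g} {u} {v} {w} je je′ e′≢e jf jg g≢f e₁ e′₁ f₂ g₂ u₁ w₂ =
    let γ′ , moves , reduced =
          reduce-path (joins-sym jf) jg je′ f₁ g₂′ e′₁′ (colours-differ γ e′₁ f₂) w₁ u₁′
    in γ′ , move f (two-at-edge γ f₂) (move e (two-at-end γ₁ je u₂) moves) ,
       trans reduced (edgeOnes-up-down γ f₂ e₁′)
    where
    γ₁ γ₂ : TotalCol G
    γ₁ = toggle γ f
    γ₂ = toggle γ₁ e
    e≢f : e ≢ f
    e≢f = colours-differ γ e₁ f₂
    w≢u : w ≢ u
    w≢u = joins-distinct jf ∘ sym
    w≢v : w ≢ v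
    w≢v refl = e≢f (joins-unique je jf)
    u₂ : vcol γ₁ u ≡ c2
    u₂ = trans (toggle-end γ jf) (cong flip u₁)
    e₁′ : ecol γ₁ e ≡ c1
    e₁′ = trans (toggle-other γ e≢f) e₁
    f₁ : ecol γ₂ f ≡ c1
    f₁ = trans (toggle-other γ₁ (e≢f ∘ sym)) (trans (toggle-edge γ f) (cong flip f₂))
    g₂′ : ecol γ₂ g ≡ c2
    g₂′ = trans (toggle-other γ₁ (colours-differ γ e₁ g₂ ∘ sym)) (trans (toggle-other γ g≢f) g₂)
    e′₁′ : ecol γ₂ e′ ≡ c1
    e′₁′ = trans (toggle-other γ₁ e′≢e) (trans (toggle-other γ (colours-differ γ e′₁ f₂)) e′₁)
    w₁ : vcol γ₂ w ≡ c1
    w₁ = trans (toggle-away γ₁ je w≢u w≢v) (trans (toggle-end γ (joins-sym jf)) (cong flip w₂))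
    u₁′ : vcol γ₂ u ≡ c1
    u₁′ = trans (toggle-end γ₁ je) (cong flip u₂)

  Joins? : ∀ e a b → Dec (Joins e a b)
  Joins? e a b = ≡-dec _≟_ _≟_ (ends G e) (a , b) ⊎-dec ≡-dec _≟_ _≟_ (ends G e) (b , a)

  Incident? : ∀ e a → Dec (Incident G e a)
  Incident? e a = (end₁ e ≟ a) ⊎-dec (end₂ e ≟ a)

  HasTwo : TotalCol G → Set
  HasTwo γ = (Σ Edge λ e → ecol γ e ≡ c2) ⊎ (Σ Vertex λ v → vcol γ v ≡ c2)

  ParityProper : TotalCol G → Set
  ParityProper γ = ∀ e → parity γ (end₁ e) ≢ parity γ (end₂ e)

  proper-joins : ∀ {γ} → ParityProper γ → ∀ {e a b} → Joins e a b → parity γ a ≢ parity γ b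
  proper-joins {γ} proper {e} (inj₁ p) =
    subst₂ (λ x y → parity γ x ≢ parity γ y) (cong proj₁ p) (cong proj₂ p) (proper e)
  proper-joins {γ} proper {e} (inj₂ p) =
    subst₂ (λ x y → parity γ x ≢ parity γ y) (cong proj₂ p) (cong proj₁ p) (proper e ∘ sym)

  proper-moves : ∀ {γ γ′} → Moves γ γ′ → ParityProper γ → ParityProper γ′
  proper-moves moves proper e same =
    proper e (trans (sym (moves-parity moves (end₁ e))) (trans same (moves-parity moves (end₂ e))))

  oddCount : TotalCol G → ℕ
  oddCount γ = sumFin (nV G) (parity γ)

  moves-oddCount : ∀ {γ γ′} → Moves γ γ′ → oddCount γ′ ≡ oddCount γ
  moves-oddCount moves = sum-cong (nV G) (moves-parity moves)

  parity≤1 : ∀ γ v → parity γ v ≤ 1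
  parity≤1 γ v = ≤-pred (m%n<n (σT G γ v) 2)

  odd-ends : ∀ {γ} → ParityProper γ → ∀ e → parity γ (end₁ e) + parity γ (end₂ e) ≡ 1
  odd-ends {γ} proper e = bits (parity≤1 γ (end₁ e)) (parity≤1 γ (end₂ e)) (proper e)
    where
    bits : ∀ {x y} → x ≤ 1 → y ≤ 1 → x ≢ y → x + y ≡ 1
    bits z≤n       z≤n       x≢y = ⊥-elim (x≢y refl)
    bits z≤n       (s≤s z≤n) _   = refl
    bits (s≤s z≤n) z≤n       _   = refl
    bits (s≤s z≤n) (s≤s z≤n) x≢y = ⊥-elim (x≢y refl)

  oddCount≤nV : ∀ γ → oddCount γ ≤ nV G
  oddCount≤nV γ = sum-≤-length (nV G) (parity γ) (parity≤1 γ)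

  count-total : ∀ γ → count1 G γ + count2 G γ ≡ nV G + nE G
  count-total γ = begin
    (V₁ + E₁) + (V₂ + E₂)   ≡⟨ interchange V₁ E₁ V₂ E₂ ⟩
    (V₁ + V₂) + (E₁ + E₂)   ≡⟨ cong₂ _+_ (all-coloured (vcol γ)) (all-coloured (ecol γ)) ⟩
    nV G + nE G             ∎
    where
    open ≡-Reasoning
    V₁ E₁ V₂ E₂ : ℕ
    V₁ = count₁ (vcol γ)
    E₁ = count₁ (ecol γ)
    V₂ = sumFin (nV G) (λ v → is2 (vcol γ v))
    E₂ = sumFin (nE G) (λ e → is2 (ecol γ e))
    all-coloured : ∀ {n} (c : Fin n → Col) → count₁ c + sumFin n (λ i → is2 (c i)) ≡ n
    all-coloured {n} c = trans (sym (sum-+ n _ _)) (trans (sum-cong n (λ i → is1+is2 (c i))) (sum-ones n))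

  -- with no 1-edges the vertex colours are dictated by the parities
  count1-without-one-edges : ∀ γ → edgeOnes γ ≡ 0 → count1 G γ ≡ oddCount γ
  count1-without-one-edges γ none = begin
    count₁ (vcol γ) + edgeOnes γ    ≡⟨ cong (count₁ (vcol γ) +_) none ⟩
    count₁ (vcol γ) + 0             ≡⟨ +-identityʳ _ ⟩
    count₁ (vcol γ)                 ≡⟨ sum-cong (nV G) (λ v → sym (vertex-parity v)) ⟩
    oddCount γ                      ∎
    where
    open ≡-Reasoning
    no-incident-ones : ∀ v → incidentOnes γ v ≡ 0
    no-incident-ones v = n≤0⇒n≡0 (subst (incidentOnes γ v ≤_) none
      (sum-mono (nE G) (λ e → masked≤ (incident? G e v) (is1 (ecol γ e)))))
      where
      masked≤ : ∀ b k → (if b then k else 0) ≤ k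
      masked≤ true  k = ≤-refl
      masked≤ false k = z≤n
    is1-parity : ∀ c → (is1 c + 0) % 2 ≡ is1 c
    is1-parity c1 = refl
    is1-parity c2 = refl
    vertex-parity : ∀ v → parity γ v ≡ is1 (vcol γ v)
    vertex-parity v = trans (parity-by-ones γ v)
      (trans (cong (λ k → (is1 (vcol γ v) + k) % 2) (no-incident-ones v)) (is1-parity (vcol γ v)))

  two-among-edges : ∀ γ → edgeOnes γ < nE G → HasTwo γ
  two-among-edges γ few with search (λ e → ecol γ e ≟ᶜ c2)
  ... | inj₁ two  = inj₁ two
  ... | inj₂ none = ⊥-elim (<-irrefl all-ones few)
    where
    all-ones : edgeOnes γ ≡ nE G
    all-ones = trans (sum-cong (nE G) (λ e → cong is1 (other-than-c2 (none e)))) (sum-ones (nE G))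

  edgeOnes≤nE : ∀ γ → edgeOnes γ ≤ nE G
  edgeOnes≤nE γ = sum-≤-length (nE G) (is1 ∘ ecol γ) (is1≤1 ∘ ecol γ)

  Stuck : TotalCol G → Set
  Stuck γ = ∀ e → ecol γ e ≡ c1 → vcol γ (end₁ e) ≡ c1 × vcol γ (end₂ e) ≡ c1

  stuck-end : ∀ {γ} → Stuck γ → ∀ {e a b} → Joins e a b → ecol γ e ≡ c1 → vcol γ a ≡ c1
  stuck-end {γ} stuck {e} (inj₁ p) e₁ = subst (λ x → vcol γ x ≡ c1) (cong proj₁ p) (proj₁ (stuck e e₁))
  stuck-end {γ} stuck {e} (inj₂ p) e₁ = subst (λ x → vcol γ x ≡ c1) (cong proj₂ p) (proj₂ (stuck e e₁))

  reducible-or-stuck : ∀ γ → Reduction γ ⊎ Stuck γ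
  reducible-or-stuck γ
    with search (λ e → (ecol γ e ≟ᶜ c1) ×-dec ((vcol γ (end₁ e) ≟ᶜ c2) ⊎-dec (vcol γ (end₂ e) ≟ᶜ c2)))
  ... | inj₁ (e , e₁ , inj₁ a₂) = inj₁ (reduce-at-end (joins-ends e) e₁ a₂)
  ... | inj₁ (e , e₁ , inj₂ b₂) = inj₁ (reduce-at-end (joins-sym (joins-ends e)) e₁ b₂)
  ... | inj₂ none = inj₂ λ e e₁ → other-than-c2 (λ a₂ → none e (e₁ , inj₁ a₂))
                                , other-than-c2 (λ b₂ → none e (e₁ , inj₂ b₂))

  -- a 1-vertex whose only 1-edge is e has even sum 1 + 1 + 2k
  lonely-one-edge : ∀ γ {e u v} → Joins e u v → vcol γ u ≡ c1 → ecol γ e ≡ c1 →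
                    (∀ g → Incident G g u → ecol γ g ≡ c1 → g ≡ e) → parity γ u ≡ 0
  lonely-one-edge γ {e} {u} j u₁ e₁ only-e = begin
    parity γ u                                ≡⟨ parity-by-ones γ u ⟩
    (is1 (vcol γ u) + incidentOnes γ u) % 2   ≡⟨ cong₂ (λ c k → (is1 c + k) % 2) u₁ one-edge ⟩
    0                                         ∎
    where
    open ≡-Reasoning
    term : Edge → ℕ
    term g = if incident? G g u then is1 (ecol γ g) else 0
    at-e : term e ≡ 1
    at-e = cong₂ (λ t c → if t then is1 c else 0) (incident?-end j) e₁
    off-e : ∀ g → g ≢ e → term g ≡ 0
    off-e g g≢e with incident? G g u in inc | ecol γ g in colour
    ... | false | _  = refl
    ... | true  | c2 = refl
    ... | true  | c1 = ⊥-elim (g≢e (only-e g (incident?→incident g u inc) colour))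
    one-edge : incidentOnes γ u ≡ 1
    one-edge = trans (sum-one-point (nE G) term e off-e) at-e

  edge-at-start : ∀ {a b} → Reach G a b → a ≢ b → Σ Edge λ e → Incident G e a
  edge-at-start here            a≢b = ⊥-elim (a≢b refl)
  edge-at-start (step (e , j) _) _  = e , joins→incident j

  -- e₀ is not the only 1-edge at both of its ends, for then both ends would
  -- have even sums
  second-one-edge : ∀ γ → ParityProper γ → Stuck γ → ∀ {e₀ u v} → Joins e₀ u v → ecol γ e₀ ≡ c1 →
                    (Σ Edge λ g → Incident G g v × ecol γ g ≡ c1 × g ≢ e₀)
                  ⊎ (Σ Edge λ g → Incident G g u × ecol γ g ≡ c1 × g ≢ e₀)
  second-one-edge γ proper stuck {e₀} {u} {v} j e₀₁
    with search (λ g → Incident? g v ×-dec (ecol γ g ≟ᶜ c1) ×-dec ¬? (g ≟ e₀))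
       | search (λ g → Incident? g u ×-dec (ecol γ g ≟ᶜ c1) ×-dec ¬? (g ≟ e₀))
  ... | inj₁ at-v | _         = inj₁ at-v
  ... | inj₂ _    | inj₁ at-u = inj₂ at-u
  ... | inj₂ none-v | inj₂ none-u =
    ⊥-elim (proper-joins {γ} proper j (trans (lonely j none-u) (sym (lonely (joins-sym j) none-v))))
    where
    lonely : ∀ {a b} → Joins e₀ a b → (∀ g → ¬ (Incident G g a × ecol γ g ≡ c1 × g ≢ e₀)) →
             parity γ a ≡ 0
    lonely jab none = lonely-one-edge γ jab (stuck-end stuck jab e₀₁) e₀₁
      (λ g ig g₁ → decidable-stable (g ≟ e₀) (λ g≢e₀ → none g (ig , g₁ , g≢e₀)))

  module _ (conn : Connected G) (nonstar : ¬ IsStar G) where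

    -- every vertex lies on an edge: a graph with a single vertex is the star K₁,₀
    vertex-on-edge : ∀ v → Σ Edge λ e → Incident G e v
    vertex-on-edge v with search (λ w → ¬? (w ≟ v))
    ... | inj₁ (w , w≢v) = edge-at-start (proj₂ conn v w) (w≢v ∘ sym)
    ... | inj₂ no-other  =
      ⊥-elim (nonstar (v , (λ w w≢v → ⊥-elim (no-other w w≢v)) , λ e → inj₁ (only-v (end₁ e))))
      where
      only-v : ∀ w → w ≡ v
      only-v w = decidable-stable (w ≟ v) (no-other w)

    star-at : ∀ u → (∀ h b g → Joins h u b → Incident G g b → g ≡ h) → IsStar G
    star-at u leaves = u , adjacent , at-u
      where
      Near : Vertex → Set
      Near x = x ≡ u ⊎ Σ Edge λ h → Joins h u x
      near-step : ∀ {x y} → Adj G x y → Near x → Near y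
      near-step (g , jg) (inj₁ refl) = inj₂ (g , jg)
      near-step (g , jg) (inj₂ (h , jh)) with leaves h _ g jh (joins→incident jg)
      ... | refl = inj₁ (joins-other jh jg)
      near : ∀ {x y} → Reach G x y → Near x → Near y
      near here           nx = nx
      near (step xy walk) nx = near walk (near-step xy nx)
      adjacent : ∀ v → v ≢ u → Adj G u v
      adjacent v v≢u with near (proj₂ conn u v) (inj₁ refl)
      ... | inj₁ v≡u = ⊥-elim (v≢u v≡u)
      ... | inj₂ uv  = uv
      at-u : ∀ e → Incident G e u
      at-u e with near (proj₂ conn u (end₁ e)) (inj₁ refl)
      ... | inj₁ a≡u   = inj₁ a≡u
      ... | inj₂ (h , jh) with leaves h (end₁ e) e jh (inj₁ refl)
      ...   | refl = joins→incident jh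

    -- In a stuck colouring with a 1-edge and a 2 somewhere, some vertex carries
    -- both a 1-edge and a 2-edge: otherwise the 1-edges spread over the whole
    -- connected graph and, by stuckness, so do the 1-vertices.
    junction : ∀ γ → Stuck γ → HasTwo γ → edgeOnes γ ≢ 0 →
               Σ Vertex λ u → Σ Edge λ e → Σ Edge λ f →
                 Incident G e u × Incident G f u × ecol γ e ≡ c1 × ecol γ f ≡ c2
    junction γ stuck two nonzero
      with search (λ u → FinP.any? (λ e → FinP.any? (λ f →
             Incident? e u ×-dec Incident? f u ×-dec (ecol γ e ≟ᶜ c1) ×-dec (ecol γ f ≟ᶜ c2))))
    ... | inj₁ (u , e , f , found) = u , e , f , found
    ... | inj₂ none = ⊥-elim (no-two two)
      where
      AllOnes : Vertex → Set
      AllOnes x = ∀ g → Incident G g x → ecol γ g ≡ c1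
      all-ones-at : ∀ {x g} → Incident G g x → ecol γ g ≡ c1 → AllOnes x
      all-ones-at {x} {g} ig g₁ g′ ig′ = other-than-c2 (λ g′₂ → none x (g , g′ , ig , ig′ , g₁ , g′₂))
      spread : ∀ {x y} → Reach G x y → AllOnes x → AllOnes y
      spread here                  all-x = all-x
      spread (step (g , jg) walk) all-x =
        spread walk (all-ones-at (joins→incident (joins-sym jg)) (all-x g (joins→incident jg)))
      first-one : Σ Edge λ e → ecol γ e ≡ c1
      first-one = let e , e≢0 = nonzero-term (nE G) (is1 ∘ ecol γ) nonzero
                  in e , other-than-c2 (λ e₂ → e≢0 (cong is1 e₂))
      everywhere : ∀ x → AllOnes x
      everywhere x = spread (proj₂ conn (end₁ (proj₁ first-one)) x)
                            (all-ones-at (inj₁ refl) (proj₂ first-one))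
      no-two : ¬ HasTwo γ
      no-two (inj₁ (e , e₂)) = c1≢c2 (trans (sym (everywhere (end₁ e) e (inj₁ refl))) e₂)
      no-two (inj₂ (v , v₂)) =
        let g , ig = vertex-on-edge v
        in c1≢c2 (trans (sym (stuck-end stuck (proj₂ (incident→joins ig)) (everywhere v g ig))) v₂)

    -- Near a vertex u with two 1-edges e₀, e′ and a 2-edge f₀, an edge h = ub
    -- with a second edge g at b allows a reduction, whatever the colours of h,
    -- b and g.
    reduce-near-branch : ∀ γ → Stuck γ → ∀ {u v y w b x e₀ e′ f₀ h g} →
      Joins e₀ u v → Joins e′ u y → e′ ≢ e₀ → Joins f₀ u w → Joins h u b → Joins g b x → g ≢ h →
      ecol γ e₀ ≡ c1 → ecol γ e′ ≡ c1 → ecol γ f₀ ≡ c2 → Reduction γ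
    reduce-near-branch γ stuck {u} {v} {y} {b = b} {e₀ = e₀} {e′} {h = h} {g}
                       je₀ je′ e′≢e₀ jf₀ jh jg g≢h e₀₁ e′₁ f₀₂ =
      by-colours (ecol γ h) (vcol γ b) (ecol γ g) refl refl refl
      where
      u₁ : vcol γ u ≡ c1
      u₁ = stuck-end stuck je₀ e₀₁
      one-edge-besides-h : Σ Edge λ k → Σ Vertex λ z → Joins k u z × ecol γ k ≡ c1 × k ≢ h
      one-edge-besides-h with e₀ ≟ h
      ... | yes refl = e′ , y , je′ , e′₁ , e′≢e₀
      ... | no e₀≢h  = e₀ , v , je₀ , e₀₁ , e₀≢h
      by-colours : ∀ ch cb cg → ecol γ h ≡ ch → vcol γ b ≡ cb → ecol γ g ≡ cg → Reduction γ
      by-colours c1 _  c1 h₁ _  g₁ =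
        reduce-path jh jf₀ jg h₁ f₀₂ g₁ g≢h u₁ (stuck-end stuck (joins-sym jh) h₁)
      by-colours c1 _  c2 h₁ _  g₂ =
        let k , z , jk , k₁ , k≢h = one-edge-besides-h
        in reduce-path (joins-sym jh) jg jk h₁ g₂ k₁ k≢h (stuck-end stuck (joins-sym jh) h₁) u₁
      by-colours c2 c1 _  h₂ b₁ _  = reduce-there-and-back je₀ jh e₀₁ h₂ u₁ b₁
      by-colours c2 c2 c1 _  b₂ g₁ = ⊥-elim (c1≢c2 (trans (sym (stuck-end stuck jg g₁)) b₂))
      by-colours c2 c2 c2 h₂ b₂ g₂ = reduce-detour je₀ je′ e′≢e₀ jh jg g≢h e₀₁ e′₁ h₂ g₂ u₁ b₂

    reduce-at-junction : ∀ γ → ParityProper γ → Stuck γ → ∀ {e₀ f₀ u v w} →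
                         Joins e₀ u v → Joins f₀ u w → ecol γ e₀ ≡ c1 → ecol γ f₀ ≡ c2 → Reduction γ
    reduce-at-junction γ proper stuck {u = u} je₀ jf₀ e₀₁ f₀₂ with second-one-edge γ proper stuck je₀ e₀₁
    ... | inj₁ (g , ig , g₁ , g≢e₀) =
      reduce-path je₀ jf₀ (proj₂ (incident→joins ig)) e₀₁ f₀₂ g₁ g≢e₀
                  (stuck-end stuck je₀ e₀₁) (stuck-end stuck (joins-sym je₀) e₀₁)
    ... | inj₂ (e′ , ie′ , e′₁ , e′≢e₀)
      with search (λ h → FinP.any? (λ b → FinP.any? (λ g → Joins? h u b ×-dec Incident? g b ×-dec ¬? (g ≟ h))))
    ...   | inj₁ (h , b , g , jh , ig , g≢h) =
      reduce-near-branch γ stuck je₀ (proj₂ (incident→joins ie′)) e′≢e₀ jf₀ jh (proj₂ (incident→joins ig))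
                         g≢h e₀₁ e′₁ f₀₂
    ...   | inj₂ no-branch = ⊥-elim (nonstar (star-at u (λ h b g jh ig →
                               decidable-stable (g ≟ h) (λ g≢h → no-branch h (b , g , jh , ig , g≢h)))))

    progress : ∀ γ → ParityProper γ → HasTwo γ → edgeOnes γ ≢ 0 → Reduction γ
    progress γ proper two nonzero with reducible-or-stuck γ
    ... | inj₁ reduction = reduction
    ... | inj₂ stuck =
      let _ , _ , _ , at-e , at-f , e₁ , f₂ = junction γ stuck two nonzero
      in reduce-at-junction γ proper stuck (proj₂ (incident→joins at-e)) (proj₂ (incident→joins at-f)) e₁ f₂

    descend : ∀ n γ → edgeOnes γ ≡ n → ParityProper γ → HasTwo γ →
              Σ (TotalCol G) λ γ′ → Moves γ γ′ × edgeOnes γ′ ≡ 0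
    descend zero    γ none    proper two = γ , stop , none
    descend (suc n) γ count-n proper two
      with progress γ proper two (λ none → 0≢1+n (trans (sym none) count-n))
    ... | γ₁ , moves₁ , reduced =
      let γ′ , moves′ , none = descend n γ₁ (suc-injective (trans reduced count-n)) (proper-moves moves₁ proper)
                                        (two-among-edges γ₁ (subst (_≤ nE G) (sym reduced) (edgeOnes≤nE γ)))
      in γ′ , moves₁ ++ᴹ moves′ , none

    -- Double counting: each vertex lies on an edge and each edge has exactly one
    -- end of odd sum, so there are at most as many odd vertices as edges.
    oddCount≤nE : ∀ γ → ParityProper γ → oddCount γ ≤ nE G
    oddCount≤nE γ proper = begin
      sumFin (nV G) (parity γ)                              ≤⟨ sum-mono (nV G) parity≤edges ⟩
      sumFin (nV G) (λ v → sumFin (nE G) (λ e → at v e))    ≡⟨ sum-swap (nV G) (nE G) at ⟩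
      sumFin (nE G) (λ e → sumFin (nV G) (λ v → at v e))    ≡⟨ sum-cong (nE G) (λ e →
                                                                 trans (sum-over-ends e (parity γ)) (odd-ends {γ} proper e)) ⟩
      sumFin (nE G) (λ _ → 1)                               ≡⟨ sum-ones (nE G) ⟩
      nE G                                                  ∎
      where
      open ≤-Reasoning
      at : Vertex → Edge → ℕ
      at v e = if incident? G e v then parity γ v else 0
      parity≤edges : ∀ v → parity γ v ≤ sumFin (nE G) (at v)
      parity≤edges v =
        let e , ie = vertex-on-edge v
        in subst (_≤ sumFin (nE G) (at v))
                 (cong (λ t → if t then parity γ v else 0) (incident?-end (proj₂ (incident→joins ie))))
                 (term≤sum (nE G) (at v) e)

    -- 2·oddCount ≤ |V| + |E| = count1 + count2 < 2·count1
    oddCount<count1 : ∀ γ → ParityProper γ → count2 G γ < count1 G γ → oddCount γ < count1 G γ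
    oddCount<count1 γ proper fewer-twos = half-< (begin-strict
      oddCount γ + oddCount γ     ≤⟨ +-mono-≤ (oddCount≤nV γ) (oddCount≤nE γ proper) ⟩
      nV G + nE G                 ≡⟨ sym (count-total γ) ⟩
      count1 G γ + count2 G γ     <⟨ +-monoʳ-< (count1 G γ) fewer-twos ⟩
      count1 G γ + count1 G γ     ∎)
      where
      open ≤-Reasoning
      half-< : ∀ {a b} → a + a < b + b → a < b
      half-< a+a<b+b = ≰⇒> (λ b≤a → <⇒≱ a+a<b+b (+-mono-≤ b≤a b≤a))

    -- The main argument: run the reductions down to a colouring without 1-edges,
    -- which has fewer 1s than γ; on the way the number of 1s passes through
    -- count1 γ − 1.
    lower-count1 : ∀ γ → ParityProper γ → HasTwo γ → count2 G γ < count1 G γ →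
                   Σ (TotalCol G) λ γ′ → Moves γ γ′ × suc (count1 G γ′) ≡ count1 G γ
    lower-count1 γ proper two fewer-twos with descend (edgeOnes γ) γ refl proper two
    ... | γ₀ , to-γ₀ , no-one-edges =
      let γ′ , to-γ′ , count-γ′ = intermediate-count to-γ₀ (pred (count1 G γ)) pred[n]≤n
                                                     (suc[m]≤n⇒m≤pred[n] fewer-ones)
      in γ′ , to-γ′ , trans (cong suc count-γ′) (suc-pred-of fewer-ones)
      where
      fewer-ones : count1 G γ₀ < count1 G γ
      fewer-ones = begin-strict
        count1 G γ₀    ≡⟨ count1-without-one-edges γ₀ no-one-edges ⟩
        oddCount γ₀    ≡⟨ moves-oddCount to-γ₀ ⟩
        oddCount γ     <⟨ oddCount<count1 γ proper fewer-twos ⟩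
        count1 G γ     ∎
        where open ≤-Reasoning
      suc-pred-of : ∀ {m n} → m < n → suc (pred n) ≡ n
      suc-pred-of (s≤s _) = refl

  -- A parity pattern as in the statement makes every edge join an even and an
  -- odd vertex, since the edges of a bipartite graph cross between the sides.
  bipartite-proper : ∀ side → IsBipartition G side → ∀ γ → ParityOK G side γ → ParityProper γ
  bipartite-proper side bip γ ok e with side (end₁ e) in s₁ | side (end₂ e) in s₂ | ok
  ... | true  | true  | _                 = ⊥-elim (bip e (trans s₁ (sym s₂)))
  ... | false | false | _                 = ⊥-elim (bip e (trans s₁ (sym s₂)))
  ... | true  | false | inj₁ (even , odd) = zero≢one (even _ s₁) (odd _ s₂)
  ... | true  | false | inj₂ (odd , even) = zero≢one (even _ s₂) (odd _ s₁) ∘ sym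
  ... | false | true  | inj₁ (even , odd) = zero≢one (even _ s₂) (odd _ s₁) ∘ sym
  ... | false | true  | inj₂ (odd , even) = zero≢one (even _ s₁) (odd _ s₂)

  parity-ok-moves : ∀ side {γ γ′} → Moves γ γ′ → ParityOK G side γ → ParityOK G side γ′
  parity-ok-moves side moves (inj₁ (even , odd)) =
    inj₁ ((λ v s → trans (moves-parity moves v) (even v s)) ,
          (λ v s → trans (moves-parity moves v) (odd v s)))
  parity-ok-moves side moves (inj₂ (odd , even)) =
    inj₂ ((λ v s → trans (moves-parity moves v) (odd v s)) ,
          (λ v s → trans (moves-parity moves v) (even v s)))

  has-two : ∀ γ → count2 G γ ≢ 0 → HasTwo γ
  has-two γ some-two with sumFin (nE G) (λ e → is2 (ecol γ e)) ≟ℕ 0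
  ... | no edge-twos =
    let e , e₂ = nonzero-term (nE G) (is2 ∘ ecol γ) edge-twos
    in inj₁ (e , other-than-c1 (e₂ ∘ cong is2))
  ... | yes no-edge-twos =
    let v , v₂ = nonzero-term (nV G) (is2 ∘ vcol γ)
                   (λ no-vertex-twos → some-two (cong₂ _+_ no-vertex-twos no-edge-twos))
    in inj₂ (v , other-than-c1 (v₂ ∘ cong is2))

  count2-rises : ∀ γ γ′ → suc (count1 G γ′) ≡ count1 G γ → count2 G γ′ ≡ suc (count2 G γ)
  count2-rises γ γ′ lowered = +-cancelˡ-≡ (count1 G γ′) _ _ (begin
    count1 G γ′ + count2 G γ′         ≡⟨ count-total γ′ ⟩
    nV G + nE G                       ≡⟨ sym (count-total γ) ⟩
    count1 G γ + count2 G γ           ≡⟨ cong (_+ count2 G γ) (sym lowered) ⟩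
    suc (count1 G γ′) + count2 G γ    ≡⟨ sym (+-suc (count1 G γ′) (count2 G γ)) ⟩
    count1 G γ′ + suc (count2 G γ)    ∎)
    where open ≡-Reasoning

lemma3 : (G : Graph) → (side : Fin (nV G) → Bool) →
         Connected G → IsBipartition G side → ¬ IsStar G →
         (γ : TotalCol G) →
         count2 G γ < count1 G γ → count2 G γ ≢ 0 →
         ParityOK G side γ →
         Σ (TotalCol G) λ γ' → ParityOK G side γ' × count2 G γ' ≡ suc (count2 G γ)
lemma3 G side conn bip nonstar γ fewer-twos some-two ok
  with lower-count1 G conn nonstar γ (bipartite-proper G side bip γ ok) (has-two G γ some-two) fewer-twos
... | γ′ , moves , lowered = γ′ , parity-ok-moves G side moves ok , count2-rises G γ γ′ lowered
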